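{- Fix $\delta \in (0,1)$ and $\epsilon \in (0,1)$. Let $k = k(n) \ge 2$ be a divisor of $n$ with $k = O(n^{\delta})$. Then any (deterministic) $\mathsf{AMPC}$ algorithm that computes the partial function $\textsc{1-vs- }k\textsc{ -Cycle}$ on $n$-vertex graphs, using machines with I/O capacity $S = n^{\epsilon}$, requires $\Omega(1/\epsilon)$ rounds.
   Context: Graphs on $n$ vertices are given by their adjacency matrix, i.e. as a string in $\{0,1\}^N$ with $N=\binom{n}{2}$, one bit per unordered pair of vertices indicating presence of that edge. For $k$ dividing $n$, $\textsc{1-vs- }k\textsc{ -Cycle}:\Delta\to\{0,1\}$ is the partial Boolean function whose domain $\Delta\subseteq\{0,1\}^N$ consists of all $n$-vertex graphs that are either a single cycle of length $n$ (value $1$) or a disjoint union of $k$ cycles each of length $n/k$ (value $0$). The (deterministic) $\mathsf{AMPC}$ model with I/O capacity $S$: computation proceeds in rounds using shared key–value stores $\mathcal{D}_0,\mathcal{D}_1,\dots$. $\mathcal{D}_0$ holds the input $x\in\{0,1\}^N$ as the $N$ pairs $(i,x_i)$. In round $r\ge1$, each machine (arbitrarily many, computationally unbounded) adaptively issues a sequence of key queries to $\mathcal{D}_{r-1}$; the response to a query is the multiset of all values stored under that key (empty if none), and later queries may depend on earlier queries and responses. For each machine in each round, the total number of values received plus the number of queries with empty response is at most $S$, and the machine writes at most $S$ key–value pairs to $\mathcal{D}_r$; values under the same key are stored as a multiset. In every round, on every input (including inputs outside $\Delta$), at most $S$ values are written under any single key. On inputs outside $\Delta$ the algorithm runs in the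 same way, and a machine whose query budget would be exceeded stops querying and writes nothing. An algorithm computes a partial function $g:\Delta\to\{0,1\}$ in $R$ rounds if for every $x\in\Delta$, $\mathcal{D}_R$ contains exactly the single pair $(\textsc{answer}, g(x))$. The lower bound holds regardless of the number of machines.
   Formalization: The exponents δ and ε are taken to be rational numbers in (0,1) rather than real, with S the integer part of n^ε; the constant in Ω(1/ε) depends only on δ. -}

module Defs where

open import Data.Nat using (ℕ; zero; suc; _+_; _*_; _∸_; _^_; _≤_; _<_; _≤?_; _<?_; _≟_; _≡ᵇ_)
open import Data.Nat.Properties using (≤-decTotalOrder)
open import Data.Bool using (Bool; true; false; if_then_else_)
open import Data.Fin using (Fin; toℕ)
open import Data.List using (List; []; _∷_; _++_; [_]; map; filter; length; concatMap; allFin)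
open import Data.List.Sort.MergeSort ≤-decTotalOrder using (mergeSort)
open import Data.List.Sort.Base using (SortingAlgorithm)
open import Data.Product using (Σ; _×_; _,_; proj₁; proj₂)
open import Data.Sum using (_⊎_)
open import Function.Bundles using (_↔_; _⇔_; Inverse)
open import Relation.Binary.PropositionalEquality using (_≡_)
open import Relation.Nullary using (yes; no)
open import Relation.Nullary.Decidable using (⌊_⌋)

-- Graphs on n vertices.
-- An input is a function x : Fin n → Fin n → Bool of which only the
-- entries x u v with u < v (one bit per unordered pair {u,v}) are used.

Graph : ℕ → Set
Graph n = Fin n → Fin n → Bool

Adj : ∀ {n} → Graph n → Fin n → Fin n → Set
Adj x u v = (toℕ u < toℕ v × x u v ≡ true) ⊎ (toℕ v < toℕ u × x v u ≡ true)

CycSucc : (m : ℕ) → Fin m → Fin m → Set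
CycSucc m i j = (suc (toℕ i) ≡ toℕ j) ⊎ (suc (toℕ i) ≡ m × toℕ j ≡ 0)

Consec : (m : ℕ) → Fin m → Fin m → Set
Consec m i j = CycSucc m i j ⊎ CycSucc m j i

IsCycleUnion : ∀ {n} → Graph n → (k m : ℕ) → Set
IsCycleUnion {n} x k m =
  Σ ((Fin k × Fin m) ↔ Fin n) λ σ →
    ∀ a b i j → Adj x (Inverse.to σ (a , i)) (Inverse.to σ (b , j)) ⇔ (a ≡ b × Consec m i j)

IsSingleCycle : ∀ {n} → Graph n → Set
IsSingleCycle {n} x = IsCycleUnion x 1 n

-- The (deterministic) AMPC model.  Keys and values are natural numbers
-- (any finite object can be encoded as one).

Store : Set
Store = ℕ → List ℕ          -- multiset of values stored under each key

storeOf : List (ℕ × ℕ) → Store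
storeOf W key = map proj₂ (filter (λ p → proj₁ p ≟ key) W)

-- the response to a query: the multiset of values under a key,
-- in canonical (sorted) form
respond : Store → ℕ → List ℕ
respond D q = SortingAlgorithm.sort mergeSort (D q)

-- history of a machine in a round: queries issued and responses received
Hist : Set
Hist = List (ℕ × List ℕ)

data Step : Set where
  query : ℕ → Step
  write : List (ℕ × ℕ) → Step

-- an adaptive (computationally unbounded) machine program for one round
Strategy : Set
Strategy = Hist → Step

cost : List ℕ → ℕ
cost []       = 1
cost (v ∷ vs) = length (v ∷ vs)

-- execution of one machine in one round against store D, with fuel and
-- remaining budget.  If the budget would be exceeded the machine stops
-- and writes nothing.  (Fuel S+1 suffices since every query costs ≥ 1.)
exec : Store → Strategy → (fuel : ℕ) → Hist → (budget : ℕ) → List (ℕ × ℕ)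
exec D σ zero    h b = []
exec D σ (suc f) h b with σ h
... | write w = w
... | query q with cost (respond D q) ≤? b
...   | yes _ = exec D σ f (h ++ [ (q , respond D q) ]) (b ∸ cost (respond D q))
...   | no  _ = []

machineWrites : (S : ℕ) → Store → Strategy → List (ℕ × ℕ)
machineWrites S D σ = exec D σ (suc S) [] S

-- an AMPC algorithm: number of rounds, (any finite) number of machines,
-- and the program of each machine in each round r ≥ 1
record AMPC : Set where
  field
    rounds   : ℕ
    machines : ℕ
    program  : ℕ → Fin machines → Strategy
open AMPC public

pairKey : (n : ℕ) → ℕ → ℕ → ℕ
pairKey n u v = suc (u * n + v)

bit : Bool → ℕ
bit false = 0
bit true  = 1

inputWrites : (n : ℕ) → Graph n → List (ℕ × ℕ)
inputWrites n x =
  concatMap (λ u → concatMap (λ v →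
     if ⌊ toℕ u <? toℕ v ⌋ then [ (pairKey n (toℕ u) (toℕ v) , bit (x u v)) ] else [])
     (allFin n)) (allFin n)

roundWrites : (S : ℕ) (A : AMPC) → ℕ → Store → List (ℕ × ℕ)
roundWrites S A r D = concatMap (λ i → machineWrites S D (program A r i)) (allFin (machines A))

storeAt : (S : ℕ) (A : AMPC) (n : ℕ) → Graph n → ℕ → Store
storeAt S A n x zero    = storeOf (inputWrites n x)
storeAt S A n x (suc r) = storeOf (roundWrites S A (suc r) (storeAt S A n x r))

-- the capacity constraints, on every input (also outside the domain)
-- and in every round 1..rounds
RespectsCapacity : (S : ℕ) (A : AMPC) (n : ℕ) → Set
RespectsCapacity S A n =
  (x : Graph n) → (r : ℕ) → r < rounds A →
    ((i : Fin (machines A)) →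
       length (machineWrites S (storeAt S A n x r) (program A (suc r) i)) ≤ S)
  × ((key : ℕ) → length (storeAt S A n x (suc r) key) ≤ S)

-- the designated key ANSWER (never used by the input store)
answerKey : ℕ
answerKey = 0

OutputIs : Store → ℕ → Set
OutputIs D v = (key : ℕ) → D key ≡ (if key ≡ᵇ answerKey then [ v ] else [])

Computes1vsKCycle : (S : ℕ) (A : AMPC) (n k : ℕ) → Set
Computes1vsKCycle S A n k =
  ((x : Graph n) → IsSingleCycle x → OutputIs (storeAt S A n x (rounds A)) 1)
  × ((x : Graph n) → (m : ℕ) → k * m ≡ n → IsCycleUnion x k m →
       OutputIs (storeAt S A n x (rounds A)) 0)

{-# OPTIONS --safe #-}
-- Write n = k m and arrange the vertices in m cyclically ordered layers of k vertices each.
-- A configuration e ∈ (ℤ/k)^m joins vertex a of layer i to vertex a + eᵢ of layer i + 1; the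
-- resulting graph is k cycles of length m if Σ eᵢ ≡ 0, and a single cycle of length n if Σ eᵢ ≡ 1.
-- A function of fewer than m of the eᵢ has the same sum over both classes of configurations,
-- because an eᵢ it ignores can be increased by one; hence so does every sum of such functions.
--
-- On the other hand, every response in round r is such a sum, with at most 2 (S (S + 1))^r
-- coordinates per summand.  One round of one machine looks at no more than S + 1 responses, and
-- inclusion–exclusion over the machines that write under a given key stops at sets of
-- size S, as no more than S values are ever written under one key.  Therefore
-- n / k = m ≤ 2 (S (S + 1))^R, which is the claimed bound on R.
module Submission where

open import Defs
open import Data.Bool using (true; false; if_then_else_)
open import Data.Fin using (Fin; zero; suc; toℕ; fromℕ<; combine; remQuot)
import Data.Fin.Properties as Fin
open import Data.Integer as ℤ using (ℤ; 0ℤ; 1ℤ)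
import Data.Integer.Properties as ℤ
import Data.Integer.Tactic.RingSolver as ℤ
open import Algebra.Properties.Semiring.Sum ℤ.+-*-semiring using (sum; sum-cong-≗; sum-replicate-zero; ∑-comm; ∑-distrib-+; *-distribʳ-sum)
open import Data.List as List using (List; []; _∷_; [_]; _++_; length; map; concat; concatMap; allFin; cartesianProductWith)
open import Data.List.Membership.DecPropositional using (_∈?_)
open import Data.List.Membership.Propositional using (_∈_; _∉_)
open import Data.List.Membership.Propositional.Properties using (∈-++⁺ˡ; ∈-++⁺ʳ; ∈-allFin; ∈-cartesianProductWith⁺; ∈-map⁺)
import Data.List.Properties as List
open import Data.List.Relation.Unary.Any as Any using (here; there)
import Data.List.Relation.Unary.Any.Properties as Any
open import Data.Nat using (ℕ; zero; suc; _+_; _*_; _∸_; _^_; _≤_; _<_; _≥_; z≤n; s≤s; _≤?_; _<?_; _≟_; NonZero)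
open import Data.Nat.DivMod using (_%_; m%n<n; %-distribˡ-+; m%n%n≡m%n; %-remove-+ʳ; m<n⇒m%n≡m; m*n%n≡0; n%n≡0; [m+n]%n≡m%n)
open import Data.Nat.Divisibility using (_∣_; divides; m%n≡0⇒n∣m)
import Data.Nat.Properties as ℕ
import Data.Nat.Tactic.RingSolver as ℕ
open import Data.Product using (Σ; ∃-syntax; _×_; _,_; proj₁; proj₂)
open import Data.Sum using (_⊎_; inj₁; inj₂; swap)
open import Data.Vec using (Vec; []; _∷_; lookup; replicate; _[_]≔_)
import Data.Vec.Properties as Vec
open import Function using (_∘_; _⇔_; mk⇔; _↔_; mk↔ₛ′; Inverse; Equivalence)
open import Relation.Binary using (DecidableEquality; tri<; tri≈; tri>)
open import Relation.Binary.PropositionalEquality using (_≡_; _≢_; refl; sym; trans; cong; cong₂; subst; subst₂; module ≡-Reasoning)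
open import Relation.Nullary using (yes; no; ¬_; Dec; does; contradiction; ¬?; _×-dec_; _⊎-dec_)
open import Relation.Nullary.Decidable using (dec-true; decidable-stable; ⌊_⌋)

-- Functions of bounded degree on configurations

Config : ℕ → ℕ → Set
Config k m = Vec (Fin k) m

configs : ∀ k m → List (Config k m)
configs k zero    = [ [] ]
configs k (suc m) = cartesianProductWith _∷_ (allFin k) (configs k m)

∈-configs : ∀ {k m} (e : Config k m) → e ∈ configs k m
∈-configs []      = here refl
∈-configs (a ∷ e) = ∈-cartesianProductWith⁺ _∷_ (∈-allFin a) (∈-configs e)

DependsOn : ∀ {k m} {A : Set} → (Config k m → A) → List (Fin m) → Set
DependsOn f l = ∀ e e′ → (∀ {i} → i ∈ l → lookup e i ≡ lookup e′ i) → f e ≡ f e′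

-- Sums of arbitrarily many juntas: only the number of coordinates read by each summand is bounded.
-- `ext` supplies closure under pointwise equality.
data Degree≤ {k m : ℕ} (d : ℕ) : (Config k m → ℤ) → Set where
  junta : ∀ {f} (l : List (Fin m)) → length l ≤ d → DependsOn f l → Degree≤ d f
  plus  : ∀ {f g} → Degree≤ d f → Degree≤ d g → Degree≤ d (λ e → f e ℤ.+ g e)
  ext   : ∀ {f g} → (∀ e → f e ≡ g e) → Degree≤ d f → Degree≤ d g

const-degree : ∀ {k m d} (c : ℤ) → Degree≤ {k} {m} d (λ _ → c)
const-degree c = junta [] z≤n (λ _ _ _ → refl)

-- Distributivity reduces the product to two juntas, and a product of juntas reads the coordinates
-- of both.
*-degree : ∀ {k m a b} {f g : Config k m → ℤ} → Degree≤ a f → Degree≤ b g →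
           Degree≤ (a + b) (λ e → f e ℤ.* g e)
*-degree {a = a} {b} (junta l l≤a p) (junta l′ l′≤b q) =
  junta (l ++ l′)
    (subst (_≤ a + b) (sym (List.length-++ l)) (ℕ.+-mono-≤ l≤a l′≤b))
    (λ e e′ agree → cong₂ ℤ._*_ (p e e′ (agree ∘ ∈-++⁺ˡ)) (q e e′ (agree ∘ ∈-++⁺ʳ l)))
*-degree {f = f} p@(junta _ _ _) (plus {g} {h} q r) =
  ext (λ e → sym (ℤ.*-distribˡ-+ (f e) (g e) (h e))) (plus (*-degree p q) (*-degree p r))
*-degree {f = f} p@(junta _ _ _) (ext eq q) = ext (λ e → cong (f e ℤ.*_) (eq e)) (*-degree p q)
*-degree {g = h} (plus {f} {g} p q) r =
  ext (λ e → sym (ℤ.*-distribʳ-+ (h e) (f e) (g e))) (plus (*-degree p r) (*-degree q r))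
*-degree {g = h} (ext eq p) q = ext (λ e → cong (ℤ._* h e) (eq e)) (*-degree p q)

-- Asking for every integer-valued test `φ` covers all indicators of values and makes any
-- post-processing of `X` free.
HasDegree : ∀ {k m} {A : Set} → ℕ → (Config k m → A) → Set
HasDegree {A = A} d X = (φ : A → ℤ) → Degree≤ d (φ ∘ X)

⟦_⟧ : ∀ {P : Set} → Dec P → ℤ
⟦ yes _ ⟧ = 1ℤ
⟦ no _ ⟧  = 0ℤ

module _ {k m d d′ : ℕ} {A : Set} (_≟ᴬ_ : DecidableEquality A) {X : Config k m → A}
         {F : A → Config k m → ℤ} (X-degree : HasDegree d X) (F-degree : ∀ a → Degree≤ d′ (F a)) where

  private
    -- The weight w drops to zero at every value already visited, so a value
    -- repeated in the list is counted only once.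
    caseSum : List A → (A → ℤ) → Config k m → ℤ
    caseSum []       w e = 0ℤ
    caseSum (a ∷ as) w e =
      (⟦ X e ≟ᴬ a ⟧ ℤ.* w (X e)) ℤ.* F a e ℤ.+ caseSum as (λ x → (1ℤ ℤ.- ⟦ x ≟ᴬ a ⟧) ℤ.* w x) e

    caseSum-degree : ∀ as w → Degree≤ (d + d′) (caseSum as w)
    caseSum-degree []       w = const-degree 0ℤ
    caseSum-degree (a ∷ as) w =
      plus (*-degree (X-degree (λ x → ⟦ x ≟ᴬ a ⟧ ℤ.* w x)) (F-degree a)) (caseSum-degree as _)

    -- The disjunction is the invariant of the recursion: the value `X e` is still to come in the
    -- list, or `w` already vanishes at it.
    caseSum-correct : ∀ as w e → X e ∈ as ⊎ w (X e) ≡ 0ℤ → caseSum as w e ≡ w (X e) ℤ.* F (X e) e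
    caseSum-correct [] w e (inj₂ w≡0) rewrite w≡0 = refl
    caseSum-correct (a ∷ as) w e h with X e ≟ᴬ a in eq
    ... | yes refl = begin
      (1ℤ ℤ.* w (X e)) ℤ.* F (X e) e ℤ.+ caseSum as w′ e
        ≡⟨ cong (λ z → (1ℤ ℤ.* w (X e)) ℤ.* F (X e) e ℤ.+ z) (caseSum-correct as w′ e (inj₂ w′≡0)) ⟩
      (1ℤ ℤ.* w (X e)) ℤ.* F (X e) e ℤ.+ w′ (X e) ℤ.* F (X e) e
        ≡⟨ cong (λ z → (1ℤ ℤ.* w (X e)) ℤ.* F (X e) e ℤ.+ z ℤ.* F (X e) e) w′≡0 ⟩
      (1ℤ ℤ.* w (X e)) ℤ.* F (X e) e ℤ.+ 0ℤ ℤ.* F (X e) e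
        ≡⟨ simplify (w (X e)) (F (X e) e) ⟩
      w (X e) ℤ.* F (X e) e ∎
      where
      open ≡-Reasoning
      w′ : A → ℤ
      w′ x = (1ℤ ℤ.- ⟦ x ≟ᴬ X e ⟧) ℤ.* w x
      w′≡0 : w′ (X e) ≡ 0ℤ
      w′≡0 rewrite eq = refl
      simplify : ∀ p q → (1ℤ ℤ.* p) ℤ.* q ℤ.+ 0ℤ ℤ.* q ≡ p ℤ.* q
      simplify = ℤ.solve-∀
    ... | no X≢a = begin
      (0ℤ ℤ.* w (X e)) ℤ.* F a e ℤ.+ caseSum as w′ e
        ≡⟨ cong (λ z → (0ℤ ℤ.* w (X e)) ℤ.* F a e ℤ.+ z) (caseSum-correct as w′ e (rest h)) ⟩
      (0ℤ ℤ.* w (X e)) ℤ.* F a e ℤ.+ w′ (X e) ℤ.* F (X e) e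
        ≡⟨ cong (λ z → (0ℤ ℤ.* w (X e)) ℤ.* F a e ℤ.+ z ℤ.* F (X e) e) w′≡w ⟩
      (0ℤ ℤ.* w (X e)) ℤ.* F a e ℤ.+ w (X e) ℤ.* F (X e) e
        ≡⟨ simplify (w (X e)) (F a e) (w (X e) ℤ.* F (X e) e) ⟩
      w (X e) ℤ.* F (X e) e ∎
      where
      open ≡-Reasoning
      w′ : A → ℤ
      w′ x = (1ℤ ℤ.- ⟦ x ≟ᴬ a ⟧) ℤ.* w x
      w′≡w : w′ (X e) ≡ w (X e)
      w′≡w rewrite eq = ℤ.*-identityˡ _
      rest : X e ∈ a ∷ as ⊎ w (X e) ≡ 0ℤ → X e ∈ as ⊎ w′ (X e) ≡ 0ℤ
      rest (inj₁ (here X≡a)) = contradiction X≡a X≢a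
      rest (inj₁ (there i))  = inj₁ i
      rest (inj₂ w≡0)        = inj₂ (trans w′≡w w≡0)
      simplify : ∀ p q r → (0ℤ ℤ.* p) ℤ.* q ℤ.+ r ≡ r
      simplify = ℤ.solve-∀

  -- Split on the value a of `X`: sum, over all a, the indicator of `X e` being a times `F a e`. The
  -- degrees add once, however many values `X` takes.
  case-degree : Degree≤ (d + d′) (λ e → F (X e) e)
  case-degree =
    ext (λ e → trans (caseSum-correct values (λ _ → 1ℤ) e (inj₁ (∈-map⁺ X (∈-configs e)))) (ℤ.*-identityˡ _))
        (caseSum-degree values (λ _ → 1ℤ))
    where
    values : List A
    values = map X (configs k m)

-- Inclusion–exclusion over the set of blocks that contribute, cut off at sets of size s:
-- a term vanishes as soon as one of its blocks is empty, so nothing is lost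
-- when at most s blocks are non-empty.
truncated : ℕ → (List ℕ → ℤ) → List (List ℕ) → ℤ
truncated s       φ []       = φ []
truncated zero    φ (w ∷ ws) = truncated zero φ ws
truncated (suc s) φ (w ∷ ws) = truncated (suc s) φ ws ℤ.+ truncated s (λ r → φ (w ++ r) ℤ.- φ r) ws

truncated-0 : ∀ s {φ} ws → (∀ r → φ r ≡ 0ℤ) → truncated s φ ws ≡ 0ℤ
truncated-0 s       []       φ≡0 = φ≡0 []
truncated-0 zero    (w ∷ ws) φ≡0 = truncated-0 zero ws φ≡0
truncated-0 (suc s) (w ∷ ws) φ≡0 =
  cong₂ ℤ._+_ (truncated-0 (suc s) ws φ≡0)
              (truncated-0 s ws (λ r → cong₂ ℤ._-_ (φ≡0 (w ++ r)) (φ≡0 r)))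

-- Only a non-empty block needs a unit of the cutoff, and it adds at least one value to the total
-- length, so the cutoff lasts; the two terms then telescope.
truncated-correct : ∀ s φ ws → length (concat ws) ≤ s → truncated s φ ws ≡ φ (concat ws)
truncated-correct s       φ []             _       = refl
truncated-correct zero    φ ([] ∷ ws)      h       = truncated-correct zero φ ws h
truncated-correct (suc s) φ ([] ∷ ws)      h       =
  trans (cong₂ ℤ._+_ (truncated-correct (suc s) φ ws h) (truncated-0 s ws (λ r → ℤ.+-inverseʳ (φ r))))
        (ℤ.+-identityʳ _)
truncated-correct (suc s) φ ((v ∷ w) ∷ ws) (s≤s h) =
  trans (cong₂ ℤ._+_ (truncated-correct (suc s) φ ws (ℕ.m≤n⇒m≤1+n short))
                     (truncated-correct s _ ws short))
        (cancel (φ (concat ws)) (φ (v ∷ w ++ concat ws)))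
  where
  short : length (concat ws) ≤ s
  short = ℕ.≤-trans (subst (length (concat ws) ≤_) (sym (List.length-++ w)) (ℕ.m≤n+m _ (length w))) h
  cancel : ∀ p q → p ℤ.+ (q ℤ.- p) ≡ q
  cancel = ℤ.solve-∀

truncated-degree : ∀ {k m d} {I : Set} {w : I → Config k m → List ℕ} → (∀ i → HasDegree d (w i)) →
                   ∀ s φ is → Degree≤ (s * d) (λ e → truncated s φ (map (λ i → w i e) is))
truncated-degree w-degree s       φ []       = const-degree _
truncated-degree w-degree zero    φ (i ∷ is) = truncated-degree w-degree zero φ is
truncated-degree {w = w} w-degree (suc s) φ (i ∷ is) =
  plus (truncated-degree w-degree (suc s) φ is)
       -- Once the value `v` of block `i` is fixed, the new functional no longer depends on `e` and
       -- the induction hypothesis applies. Each unit of `s` pays for one such split.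
       (case-degree (List.≡-dec _≟_)
          {F = λ v e → truncated s (λ r → φ (v ++ r) ℤ.- φ r) (map (λ i → w i e) is)}
          (w-degree i) (λ v → truncated-degree w-degree s _ is))

-- The degree is governed by the total length and not by the number of blocks, so the estimate is
-- uniform in the number of machines.
concatMap-degree : ∀ {k m d s} {I : Set} {w : I → Config k m → List ℕ} is →
                   (∀ i → HasDegree d (w i)) → (∀ e → length (concatMap (λ i → w i e) is) ≤ s) →
                   HasDegree (s * d) (λ e → concatMap (λ i → w i e) is)
concatMap-degree {s = s} {w = w} is w-degree short φ =
  ext (λ e → truncated-correct s φ (map (λ i → w i e) is) (short e)) (truncated-degree w-degree s φ is)

-- The degree of what an AMPC algorithm stores

-- What `exec` does after receiving the response `v`; as a separate argument, `v` can be held fixed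
-- while the store varies.
resume : Store → Strategy → ℕ → Hist → ℕ → ℕ → List ℕ → List (ℕ × ℕ)
resume D σ f h b q v with cost v ≤? b
... | yes _ = exec D σ f (h ++ [ (q , v) ]) (b ∸ cost v)
... | no _  = []

exec-write : ∀ {w} D σ f h b → σ h ≡ write w → exec D σ (suc f) h b ≡ w
exec-write D σ f h b eq rewrite eq = refl

exec-query : ∀ {q} D σ f h b → σ h ≡ query q → exec D σ (suc f) h b ≡ resume D σ f h b q (respond D q)
exec-query {q} D σ f h b eq rewrite eq with cost (respond D q) ≤? b
... | yes _ = refl
... | no _  = refl

-- A machine is a decision tree: each unit of fuel allows one query, and splitting on its response
-- adds `d`.
exec-degree : ∀ {k m d} {D : Config k m → Store} → (∀ q → HasDegree d (λ e → respond (D e) q)) →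
              ∀ σ f h b → HasDegree (f * d) (λ e → exec (D e) σ f h b)
exec-degree D-degree σ zero    h b φ = const-degree _
exec-degree {d = d} {D} D-degree σ (suc f) h b φ = byStep (σ h) refl
  where
  byStep : ∀ st → σ h ≡ st → Degree≤ (suc f * d) (λ e → φ (exec (D e) σ (suc f) h b))
  resume-degree : ∀ q v → Degree≤ (f * d) (λ e → φ (resume (D e) σ f h b q v))
  resume-degree q v with cost v ≤? b
  ... | yes _ = exec-degree D-degree σ f _ _ φ
  ... | no _  = const-degree _
  byStep (write w) eq = ext (λ e → cong φ (sym (exec-write (D e) σ f h b eq))) (const-degree (φ w))
  byStep (query q) eq =
    ext (λ e → cong φ (sym (exec-query (D e) σ f h b eq)))
        (case-degree (List.≡-dec _≟_) {F = λ v e → φ (resume (D e) σ f h b q v)}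
                     (D-degree q) (resume-degree q))

storeOf-concatMap : ∀ {I : Set} (W : I → List (ℕ × ℕ)) is key →
                    storeOf (concatMap W is) key ≡ concatMap (λ i → storeOf (W i) key) is
storeOf-concatMap W []       key = refl
storeOf-concatMap W (i ∷ is) key = begin
  storeOf (W i ++ concatMap W is) key
    ≡⟨ cong (map proj₂) (List.filter-++ (λ p → proj₁ p ≟ key) (W i) _) ⟩
  map proj₂ (List.filter (λ p → proj₁ p ≟ key) (W i) ++ List.filter (λ p → proj₁ p ≟ key) (concatMap W is))
    ≡⟨ List.map-++ proj₂ (List.filter (λ p → proj₁ p ≟ key) (W i)) _ ⟩
  storeOf (W i) key ++ storeOf (concatMap W is) key
    ≡⟨ cong (storeOf (W i) key ++_) (storeOf-concatMap W is key) ⟩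
  storeOf (W i) key ++ concatMap (λ i → storeOf (W i) key) is ∎
  where open ≡-Reasoning

-- A round multiplies by `suc S`, the fuel of `exec`, and by `S`, the bound on the values under one
-- key.
degreeAfter : ℕ → ℕ → ℕ → ℕ
degreeAfter S d zero    = d
degreeAfter S d (suc r) = S * (suc S * degreeAfter S d r)

-- Induction on rounds: `exec-degree` treats one machine, and `concatMap-degree` merges what all
-- machines write under the key `q`.
storeAt-degree : ∀ {k m d} S A n (G : Config k m → Graph n) → RespectsCapacity S A n →
                 (∀ q → HasDegree d (λ e → respond (storeAt S A n (G e) 0) q)) →
                 ∀ r → r ≤ rounds A →
                 ∀ q → HasDegree (degreeAfter S d r) (λ e → respond (storeAt S A n (G e) r) q)
storeAt-degree S A n G capacity input zero    _   = input
storeAt-degree S A n G capacity input (suc r) r<R q φ =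
  ext (λ e → cong (λ vs → φ (respond (λ _ → vs) q)) (sym (split e)))
      (concatMap-degree (allFin (machines A))
         (λ i ψ → exec-degree (storeAt-degree S A n G capacity input r (ℕ.<⇒≤ r<R)) (program A (suc r) i)
                              (suc S) [] S (λ W → ψ (storeOf W q)))
         -- The cap on values per key is invoked at every `G e`, including graphs outside the domain
         -- of the problem.
         (λ e → subst (λ vs → length vs ≤ S) (split e) (proj₂ (capacity (G e) r r<R) q))
         (λ vs → φ (respond (λ _ → vs) q)))
  where
  split : ∀ e → storeAt S A n (G e) (suc r) q ≡
                concatMap (λ i → storeOf (machineWrites S (storeAt S A n (G e) r) (program A (suc r) i)) q)
                          (allFin (machines A))
  split e = storeOf-concatMap _ (allFin (machines A)) q

-- Orthogonality to functions of degree less than m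

sumConfigs : ∀ {k} m → (Config k m → ℤ) → ℤ
sumConfigs zero    f = f []
sumConfigs (suc m) f = sum (λ a → sumConfigs m (λ e → f (a ∷ e)))

sumConfigs-cong : ∀ {k} m {f g : Config k m → ℤ} → (∀ e → f e ≡ g e) → sumConfigs m f ≡ sumConfigs m g
sumConfigs-cong zero    f≗g = f≗g []
sumConfigs-cong (suc m) f≗g = sum-cong-≗ (λ a → sumConfigs-cong m (λ e → f≗g (a ∷ e)))

sumConfigs-0 : ∀ {k} m → sumConfigs {k} m (λ _ → 0ℤ) ≡ 0ℤ
sumConfigs-0     zero    = refl
sumConfigs-0 {k} (suc m) = trans (sum-cong-≗ {k} (λ _ → sumConfigs-0 m)) (sum-replicate-zero k)

sumConfigs-+ : ∀ {k} m (f g : Config k m → ℤ) →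
               sumConfigs m (λ e → f e ℤ.+ g e) ≡ sumConfigs m f ℤ.+ sumConfigs m g
sumConfigs-+ zero    f g = refl
sumConfigs-+ (suc m) f g =
  trans (sum-cong-≗ (λ a → sumConfigs-+ m (f ∘ (a ∷_)) (g ∘ (a ∷_)))) (∑-distrib-+ (λ a → sumConfigs m (f ∘ (a ∷_))) (λ a → sumConfigs m (g ∘ (a ∷_))))

sum-sumConfigs-comm : ∀ {j k} m (f : Fin j → Config k m → ℤ) →
                      sum (λ a → sumConfigs m (f a)) ≡ sumConfigs m (λ e → sum (λ a → f a e))
sum-sumConfigs-comm zero    f = refl
sum-sumConfigs-comm (suc m) f =
  trans (∑-comm (λ a b → sumConfigs m (λ e → f a (b ∷ e))))
        (sum-cong-≗ (λ b → sum-sumConfigs-comm m (λ a e → f a (b ∷ e))))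

sum-nonneg : ∀ {n} (f : Fin n → ℤ) → (∀ i → 0ℤ ℤ.≤ f i) → 0ℤ ℤ.≤ sum f
sum-nonneg {zero}  f f≥0 = ℤ.≤-refl
sum-nonneg {suc n} f f≥0 = ℤ.+-mono-≤ (f≥0 zero) (sum-nonneg (f ∘ suc) (f≥0 ∘ suc))

term≤sum : ∀ {n} (f : Fin n → ℤ) → (∀ i → 0ℤ ℤ.≤ f i) → ∀ i → f i ℤ.≤ sum f
term≤sum f f≥0 zero    =
  subst (ℤ._≤ sum f) (ℤ.+-identityʳ _) (ℤ.+-monoʳ-≤ (f zero) (sum-nonneg (f ∘ suc) (f≥0 ∘ suc)))
term≤sum f f≥0 (suc i) =
  subst (ℤ._≤ sum f) (ℤ.+-identityˡ _) (ℤ.+-mono-≤ (f≥0 zero) (term≤sum (f ∘ suc) (f≥0 ∘ suc) i))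

sumConfigs-nonneg : ∀ {k} m (f : Config k m → ℤ) → (∀ e → 0ℤ ℤ.≤ f e) → 0ℤ ℤ.≤ sumConfigs m f
sumConfigs-nonneg zero    f f≥0 = f≥0 []
sumConfigs-nonneg (suc m) f f≥0 = sum-nonneg _ (λ a → sumConfigs-nonneg m _ (λ e → f≥0 (a ∷ e)))

term≤sumConfigs : ∀ {k} m (f : Config k m → ℤ) → (∀ e → 0ℤ ℤ.≤ f e) → ∀ e → f e ℤ.≤ sumConfigs m f
term≤sumConfigs zero    f f≥0 []      = ℤ.≤-refl
term≤sumConfigs (suc m) f f≥0 (a ∷ e) =
  ℤ.≤-trans (term≤sumConfigs m (f ∘ (a ∷_)) (λ e → f≥0 (a ∷ e)) e)
            (term≤sum _ (λ a → sumConfigs-nonneg m _ (λ e → f≥0 (a ∷ e))) a)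

sum-telescope : ∀ k (g : ℕ → ℤ) t →
                sum {k} (λ a → g (suc (t + toℕ a)) ℤ.- g (t + toℕ a)) ≡ g (t + k) ℤ.- g t
sum-telescope zero g t rewrite ℕ.+-identityʳ t = sym (ℤ.+-inverseʳ (g t))
sum-telescope (suc k) g t = begin
  (g (suc (t + 0)) ℤ.- g (t + 0)) ℤ.+ sum {k} (λ a → g (suc (t + suc (toℕ a))) ℤ.- g (t + suc (toℕ a)))
    ≡⟨ cong₂ ℤ._+_ (cong (λ s → g (suc s) ℤ.- g s) (ℕ.+-identityʳ t))
                   (sum-cong-≗ {k} (λ a → cong (λ s → g (suc s) ℤ.- g s) (ℕ.+-suc t (toℕ a)))) ⟩
  (g (suc t) ℤ.- g t) ℤ.+ sum {k} (λ a → g (suc (suc t + toℕ a)) ℤ.- g (suc t + toℕ a))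
    ≡⟨ cong (λ z → (g (suc t) ℤ.- g t) ℤ.+ z) (sum-telescope k g (suc t)) ⟩
  (g (suc t) ℤ.- g t) ℤ.+ (g (suc t + k) ℤ.- g (suc t))
    ≡⟨ cancel (g (suc t)) (g t) (g (suc t + k)) ⟩
  g (suc t + k) ℤ.- g t
    ≡⟨ cong (λ s → g s ℤ.- g t) (sym (ℕ.+-suc t k)) ⟩
  g (t + suc k) ℤ.- g t ∎
  where
  open ≡-Reasoning
  cancel : ∀ p q r → (p ℤ.- q) ℤ.+ (r ℤ.- p) ≡ r ℤ.- q
  cancel = ℤ.solve-∀

total : ∀ {k m} → Config k m → ℕ
total []      = 0
total (a ∷ e) = toℕ a + total e

-- Zero sum over every window of `k` consecutive arguments. Comparing neighbouring windows shows
-- that such a `θ` has period `k`, so it is a weight on residues with sum zero.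
Balanced : ℕ → (ℕ → ℤ) → Set
Balanced k θ = ∀ t → sum {k} (λ a → θ (t + toℕ a)) ≡ 0ℤ

-- Changing a coordinate j that f ignores runs θ through a full period.
balanced-orthogonal-fresh : ∀ {k m θ} → Balanced k θ → (j : Fin m) (f : Config k m → ℤ) →
                            (∀ e a → f (e [ j ]≔ a) ≡ f e) → ∀ t →
                            sumConfigs m (λ e → θ (t + total e) ℤ.* f e) ≡ 0ℤ
balanced-orthogonal-fresh {zero}          bal zero    f indep t = refl
balanced-orthogonal-fresh {suc k} {suc m} {θ} bal zero f indep t = begin
  sum {suc k} (λ a → sumConfigs m (λ e → θ (t + (toℕ a + total e)) ℤ.* f (a ∷ e)))
    -- `indep` resets the first coordinate to `zero` inside `f`, which makes `f` a common factor of
    -- the sum over `a`.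
    ≡⟨ sum-cong-≗ {suc k} (λ a → sumConfigs-cong m (λ e →
         cong₂ ℤ._*_ (cong θ (rearrange (toℕ a) (total e))) (sym (indep (a ∷ e) zero)))) ⟩
  sum {suc k} (λ a → sumConfigs m (λ e → θ ((t + total e) + toℕ a) ℤ.* f (zero ∷ e)))
    ≡⟨ sum-sumConfigs-comm {suc k} m (λ a e → θ ((t + total e) + toℕ a) ℤ.* f (zero ∷ e)) ⟩
  sumConfigs m (λ e → sum {suc k} (λ a → θ ((t + total e) + toℕ a) ℤ.* f (zero ∷ e)))
    ≡⟨ sumConfigs-cong m (λ e → trans (sym (*-distribʳ-sum {suc k} (f (zero ∷ e)) (λ a → θ ((t + total e) + toℕ a))))
         (cong (ℤ._* f (zero ∷ e)) (bal (t + total e)))) ⟩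
  sumConfigs m (λ e → 0ℤ ℤ.* f (zero ∷ e))
    ≡⟨ sumConfigs-0 m ⟩
  0ℤ ∎
  where
  open ≡-Reasoning
  rearrange : ∀ a s → t + (a + s) ≡ (t + s) + a
  rearrange a s = trans (cong (t +_) (ℕ.+-comm a s)) (sym (ℕ.+-assoc t s a))
-- A coordinate in front of the ignored one is absorbed into the offset `t`.
balanced-orthogonal-fresh {k} {suc m} {θ} bal (suc j) f indep t =
  trans (sum-cong-≗ (λ a → trans
          (sumConfigs-cong m (λ e → cong (λ s → θ s ℤ.* f (a ∷ e)) (sym (ℕ.+-assoc t (toℕ a) (total e)))))
          (balanced-orthogonal-fresh {θ = θ} bal j (f ∘ (a ∷_)) (λ e → indep (a ∷ e)) (t + toℕ a))))
        (sum-replicate-zero k)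

-- Pigeonhole: if every `j` occurred in `l`, two of them would share a position.
fresh : ∀ {m} (l : List (Fin m)) → length l < m → ∃[ j ] j ∉ l
fresh l l<m with Fin.any? (λ j → ¬? (_∈?_ Fin._≟_ j l))
... | yes found = found
... | no none   = contradiction collision λ (i , j , i<j , eq) →
                    ℕ.<⇒≢ i<j (cong toℕ (same-index (mem i) (mem j) eq))
  where
  mem : ∀ j → j ∈ l
  mem j = decidable-stable (_∈?_ Fin._≟_ j l) (λ j∉l → none (j , j∉l))
  collision = Fin.pigeonhole l<m (Any.index ∘ mem)
  same-index : ∀ {i j} {l : List (Fin _)} (p : i ∈ l) (q : j ∈ l) → Any.index p ≡ Any.index q → i ≡ j
  same-index {l = l} p q eq = trans (Any.lookup-index p) (trans (cong (List.lookup l) eq) (sym (Any.lookup-index q)))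

-- By linearity a single junta suffices, and a junta reading fewer than `m` coordinates ignores one.
balanced-orthogonal : ∀ {k m d θ} {f : Config k m → ℤ} → Balanced k θ → d < m → Degree≤ d f →
                      sumConfigs m (λ e → θ (total e) ℤ.* f e) ≡ 0ℤ
balanced-orthogonal {θ = θ} {f} bal d<m (junta l l≤d dep) =
  let (j , j∉l) = fresh l (ℕ.≤-<-trans l≤d d<m) in
  balanced-orthogonal-fresh {θ = θ} bal j f
    (λ e a → dep _ _ (λ i∈l → Vec.lookup∘update′ (λ i≡j → j∉l (subst (_∈ l) i≡j i∈l)) e a)) 0
balanced-orthogonal {m = m} {θ = θ} bal d<m (plus {f} {g} p q) =
  trans (sumConfigs-cong m (λ e → ℤ.*-distribˡ-+ (θ (total e)) (f e) (g e)))
  (trans (sumConfigs-+ m (λ e → θ (total e) ℤ.* f e) (λ e → θ (total e) ℤ.* g e))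
         (cong₂ ℤ._+_ (balanced-orthogonal {θ = θ} bal d<m p) (balanced-orthogonal {θ = θ} bal d<m q)))
balanced-orthogonal {m = m} {θ = θ} bal d<m (ext f≗g p) =
  trans (sumConfigs-cong m (λ e → cong (θ (total e) ℤ.*_) (sym (f≗g e)))) (balanced-orthogonal {θ = θ} bal d<m p)

-- Layered graphs

CycSucc? : ∀ m i j → Dec (CycSucc m i j)
CycSucc? m i j = (suc (toℕ i) ≟ toℕ j) ⊎-dec ((suc (toℕ i) ≟ m) ×-dec (toℕ j ≟ 0))

CycSucc-functional : ∀ {m i j j′} → CycSucc m i j → CycSucc m i j′ → j ≡ j′
CycSucc-functional         (inj₁ p)       (inj₁ q)       = Fin.toℕ-injective (trans (sym p) q)
CycSucc-functional {j = j} (inj₁ p)       (inj₂ (q , _)) = contradiction (trans (sym p) q) (ℕ.<⇒≢ (Fin.toℕ<n j))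
CycSucc-functional {j′ = j} (inj₂ (p , _)) (inj₁ q)      = contradiction (trans (sym q) p) (ℕ.<⇒≢ (Fin.toℕ<n j))
CycSucc-functional         (inj₂ (_ , p)) (inj₂ (_ , q)) = Fin.toℕ-injective (trans p (sym q))

CycSucc-total : ∀ {m} (i : Fin m) → ∃[ j ] CycSucc m i j
CycSucc-total {suc m} i with suc (toℕ i) <? suc m
... | yes i<m = fromℕ< i<m , inj₁ (sym (Fin.toℕ-fromℕ< i<m))
... | no i≮m  = zero , inj₂ (ℕ.≤-antisym (Fin.toℕ<n i) (ℕ.≮⇒≥ i≮m) , refl)

CycSucc-irreflexive : ∀ {m i} → 2 ≤ m → ¬ CycSucc m i i
CycSucc-irreflexive         2≤m (inj₁ p)       = ℕ.1+n≢n p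
CycSucc-irreflexive {i = i} 2≤m (inj₂ (p , q)) =
  ℕ.<⇒≢ 2≤m (trans (cong suc (sym q)) p)

-- The successor of (c , i) when Fin k × Fin m is read as one block of m positions per c < k.
LexSucc : ∀ {k m} → Fin k × Fin m → Fin k × Fin m → Set
LexSucc {k} {m} (c , i) (c′ , i′) =
  (suc (toℕ i) ≡ toℕ i′ × c ≡ c′) ⊎ ((suc (toℕ i) ≡ m × toℕ i′ ≡ 0) × CycSucc k c c′)

LexSucc-total : ∀ {k m} (p : Fin k × Fin m) → ∃[ q ] LexSucc p q
LexSucc-total (c , i) with CycSucc-total i | CycSucc-total c
... | j , inj₁ next | _       = (c , j) , inj₁ (next , refl)
... | j , inj₂ wrap | c′ , s = (c′ , j) , inj₂ (wrap , s)

-- `combine c i` has position m * c + i, so the step after the last position of block c lands on m *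
-- (c + 1).
LexSucc⇒CycSucc : ∀ {k m} {c c′ : Fin k} {i i′ : Fin m} → LexSucc (c , i) (c′ , i′) →
                  CycSucc (k * m) (combine c i) (combine c′ i′)
LexSucc⇒CycSucc {k} {m} {c} {c′} {i} {i′} = convert
  where
  next : suc (toℕ (combine c i)) ≡ m * toℕ c + suc (toℕ i)
  next = trans (cong suc (Fin.toℕ-combine c i)) (sym (ℕ.+-suc _ _))
  wrap : suc (toℕ i) ≡ m → suc (toℕ (combine c i)) ≡ m * suc (toℕ c)
  wrap p = trans next (trans (cong (m * toℕ c +_) p) (trans (ℕ.+-comm _ m) (sym (ℕ.*-suc m (toℕ c)))))
  first : ∀ {x} → toℕ c′ ≡ x → toℕ i′ ≡ 0 → toℕ (combine c′ i′) ≡ m * x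
  first refl q = trans (Fin.toℕ-combine c′ i′) (trans (cong (m * toℕ c′ +_) q) (ℕ.+-identityʳ _))
  convert : LexSucc (c , i) (c′ , i′) → CycSucc (k * m) (combine c i) (combine c′ i′)
  convert (inj₁ (p , refl)) =
    inj₁ (trans next (trans (cong (m * toℕ c +_) p) (sym (Fin.toℕ-combine c i′))))
  convert (inj₂ ((p , q) , inj₁ r)) = inj₁ (trans (wrap p) (sym (first (sym r) q)))
  convert (inj₂ ((p , q) , inj₂ (r , r′))) =
    inj₂ (trans (wrap p) (trans (cong (m *_) r) (ℕ.*-comm m k)) , trans (first r′ q) (ℕ.*-zeroʳ m))

CycSucc⇔LexSucc : ∀ {k m} (t t′ : Fin (k * m)) →
                  CycSucc (k * m) t t′ ⇔ LexSucc (remQuot {k} m t) (remQuot {k} m t′)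
CycSucc⇔LexSucc {k} {m} t t′ = mk⇔ to from
  where
  combined : ∀ {t t′} → LexSucc (remQuot {k} m t) (remQuot {k} m t′) → CycSucc (k * m) t t′
  combined {t} {t′} s =
    subst₂ (CycSucc (k * m)) (Fin.combine-remQuot {k} m t) (Fin.combine-remQuot {k} m t′) (LexSucc⇒CycSucc s)
  from = combined
  to : CycSucc (k * m) t t′ → LexSucc (remQuot {k} m t) (remQuot {k} m t′)
  -- The converse follows from the first direction: some lexicographic successor exists, it is a
  -- cyclic successor, and those are unique.
  to s with LexSucc-total (remQuot {k} m t)
  ... | (c , i) , lex = subst (LexSucc (remQuot {k} m t)) (sym decoded) lex
    where
    s′ : CycSucc (k * m) t (combine c i)
    s′ = subst (λ u → CycSucc (k * m) u (combine c i)) (Fin.combine-remQuot {k} m t) (LexSucc⇒CycSucc lex)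
    decoded : remQuot {k} m t′ ≡ (c , i)
    decoded = trans (cong (remQuot {k} m) (CycSucc-functional s s′)) (Fin.remQuot-combine c i)

-- Rotations of the columns and the cycles of a layered graph

module _ {k : ℕ} .{{_ : NonZero k}} where

  shift : ℕ → Fin k → Fin k
  shift t x = fromℕ< (m%n<n (toℕ x + t) k)

  toℕ-shift : ∀ t x → toℕ (shift t x) ≡ (toℕ x + t) % k
  toℕ-shift t x = Fin.toℕ-fromℕ< (m%n<n (toℕ x + t) k)

  shift-shift : ∀ s t x → shift s (shift t x) ≡ shift (t + s) x
  shift-shift s t x = Fin.toℕ-injective (begin
    toℕ (shift s (shift t x))            ≡⟨ toℕ-shift s _ ⟩
    (toℕ (shift t x) + s) % k            ≡⟨ cong (λ z → (z + s) % k) (toℕ-shift t x) ⟩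
    ((toℕ x + t) % k + s) % k            ≡⟨ %-distribˡ-+ ((toℕ x + t) % k) s k ⟩
    ((toℕ x + t) % k % k + s % k) % k    ≡⟨ cong (λ z → (z + s % k) % k) (m%n%n≡m%n (toℕ x + t) k) ⟩
    ((toℕ x + t) % k + s % k) % k        ≡⟨ %-distribˡ-+ (toℕ x + t) s k ⟨
    (toℕ x + t + s) % k                  ≡⟨ cong (_% k) (ℕ.+-assoc (toℕ x) t s) ⟩
    (toℕ x + (t + s)) % k                ≡⟨ toℕ-shift (t + s) x ⟨
    toℕ (shift (t + s) x)                ∎)
    where open ≡-Reasoning

  shift-multiple : ∀ t → t % k ≡ 0 → ∀ x → shift t x ≡ x
  shift-multiple t t≡0 x = Fin.toℕ-injective
    (trans (toℕ-shift t x) (trans (%-remove-+ʳ (toℕ x) (m%n≡0⇒n∣m t k t≡0)) (m<n⇒m%n≡m (Fin.toℕ<n x))))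

  -- `t * (k ∸ 1)` is a natural number congruent to -t modulo `k`.
  unshift : ℕ → Fin k → Fin k
  unshift t = shift (t * (k ∸ 1))

  private
    full-turn : ∀ t → (t + t * (k ∸ 1)) % k ≡ 0
    full-turn t = trans (cong (_% k) (trans (sym (ℕ.*-suc t (k ∸ 1))) (cong (t *_) (ℕ.suc-pred k)))) (m*n%n≡0 t k)

  unshift-shift : ∀ t x → unshift t (shift t x) ≡ x
  unshift-shift t x = trans (shift-shift _ t x) (shift-multiple _ (full-turn t) x)

  shift-unshift : ∀ t x → shift t (unshift t x) ≡ x
  shift-unshift t x =
    trans (shift-shift t _ x) (shift-multiple _ (trans (cong (_% k) (ℕ.+-comm _ t)) (full-turn t)) x)

  shift-injective : ∀ t {x y} → shift t x ≡ shift t y → x ≡ y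
  shift-injective t {x} {y} eq = trans (sym (unshift-shift t x)) (trans (cong (unshift t) eq) (unshift-shift t y))

  -- The hypothesis says t ≡ 1 modulo `k`. Both rotations become the identity after a further
  -- rotation by `k ∸ 1`, which is injective.
  shift-≡1 : ∀ t → (t + (k ∸ 1)) % k ≡ 0 → ∀ x → shift t x ≡ shift 1 x
  shift-≡1 t h x = shift-injective (k ∸ 1)
    (trans (trans (shift-shift (k ∸ 1) t x) (shift-multiple _ h x))
           (sym (trans (shift-shift (k ∸ 1) 1 x)
                       (shift-multiple _ (trans (cong (_% k) (ℕ.suc-pred k)) (n%n≡0 k)) x))))

  CycSucc-shift-1 : ∀ x → CycSucc k x (shift 1 x)
  CycSucc-shift-1 x with suc (toℕ x) <? k
  ... | yes lt = inj₁ (sym (trans (toℕ-shift 1 x) (trans (cong (_% k) (ℕ.+-comm (toℕ x) 1)) (m<n⇒m%n≡m lt))))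
  ... | no ≮k  = inj₂ (last , trans (toℕ-shift 1 x)
                   (trans (cong (_% k) (trans (ℕ.+-comm (toℕ x) 1) last)) (n%n≡0 k)))
    where
    last : suc (toℕ x) ≡ k
    last = ℕ.≤-antisym (Fin.toℕ<n x) (ℕ.≮⇒≥ ≮k)

  module _ {m : ℕ} where

    -- Takes one offset `s` instead of a configuration, so that an adjacency visibly reads only the
    -- coordinates of two layers.
    Joined : Fin k → Fin k × Fin m → Fin k × Fin m → Set
    Joined s (a , i) (b , j) = CycSucc m i j × b ≡ shift (toℕ s) a

    Joined? : ∀ s u v → Dec (Joined s u v)
    Joined? s (a , i) (b , j) = CycSucc? m i j ×-dec (b Fin.≟ shift (toℕ s) a)

    layer : Fin (k * m) → Fin m
    layer u = proj₂ (remQuot {k} m u)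

    Edge : Config k m → Fin k × Fin m → Fin k × Fin m → Set
    Edge e u v = Joined (lookup e (proj₂ u)) u v

    Linked? : ∀ e u v → Dec (Edge e u v ⊎ Edge e v u)
    Linked? e u v = Joined? (lookup e (proj₂ u)) u v ⊎-dec Joined? (lookup e (proj₂ v)) v u

    -- Column a of layer i is joined to column a + eᵢ mod k of layer i + 1 mod m.
    layered : Config k m → Graph (k * m)
    layered e u v = does (Linked? e (remQuot m u) (remQuot m v))

    does-true⁻ : ∀ {P : Set} (P? : Dec P) → does P? ≡ true → P
    does-true⁻ (yes p) _ = p

    -- With at least two layers an edge has its ends in different layers. They are then distinct
    -- vertices, and since linkage is symmetric either order may be the one stored.
    Adj-layered : 2 ≤ m → ∀ e p q →
                  Adj (layered e) (combine (proj₁ p) (proj₂ p)) (combine (proj₁ q) (proj₂ q)) ⇔ (Edge e p q ⊎ Edge e q p)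
    Adj-layered 2≤m e p@(a , i) q@(b , j) = mk⇔ to from
      where
      layered-combine : ∀ a i b j →
        layered e (combine a i) (combine b j) ≡ does (Linked? e (a , i) (b , j))
      layered-combine a i b j =
        cong₂ (λ u v → does (Linked? e u v)) (Fin.remQuot-combine a i) (Fin.remQuot-combine b j)
      to : Adj (layered e) (combine a i) (combine b j) → Edge e p q ⊎ Edge e q p
      to (inj₁ (_ , x)) = does-true⁻ (Linked? e p q) (trans (sym (layered-combine a i b j)) x)
      to (inj₂ (_ , x)) = swap (does-true⁻ (Linked? e q p) (trans (sym (layered-combine b j a i)) x))
      distinct : Edge e p q ⊎ Edge e q p → i ≢ j
      distinct (inj₁ (s , _)) refl = CycSucc-irreflexive 2≤m s
      distinct (inj₂ (s , _)) refl = CycSucc-irreflexive 2≤m s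
      from : Edge e p q ⊎ Edge e q p → Adj (layered e) (combine a i) (combine b j)
      from y with Fin.<-cmp (combine a i) (combine b j)
      ... | tri< lt _ _ = inj₁ (lt , trans (layered-combine a i b j) (dec-true (Linked? e p q) y))
      ... | tri≈ _ eq _ = contradiction (Fin.combine-injectiveʳ a i b j eq) (distinct y)
      ... | tri> _ _ gt = inj₂ (gt , trans (layered-combine b j a i) (dec-true (Linked? e q p) (swap y)))

  -- Indexed by naturals so that position `m`, just past the last layer, is covered; there it equals
  -- `total`.
  prefix : ∀ {m} → Config k m → ℕ → ℕ
  prefix e       zero    = 0
  prefix []      (suc i) = 0
  prefix (a ∷ e) (suc i) = toℕ a + prefix e i

  prefix-suc : ∀ {m} (e : Config k m) i → prefix e (toℕ i) + toℕ (lookup e i) ≡ prefix e (suc (toℕ i))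
  prefix-suc (a ∷ e) zero    = sym (ℕ.+-identityʳ (toℕ a))
  prefix-suc (a ∷ e) (suc i) = trans (ℕ.+-assoc (toℕ a) _ _) (cong (toℕ a +_) (prefix-suc e i))

  prefix-total : ∀ {m} (e : Config k m) → prefix e m ≡ total e
  prefix-total []      = refl
  prefix-total (a ∷ e) = cong (toℕ a +_) (prefix-total e)

  module _ {m : ℕ} (e : Config k m) where

    twist : Fin k × Fin m → Fin k × Fin m
    twist (a , i) = shift (prefix e (toℕ i)) a , i

    -- Following column a from layer 0 straightens every edge except those closing up the last layer.
    place : (Fin k × Fin m) ↔ Fin (k * m)
    place = mk↔ₛ′ to from to-from from-to
      where
      to : Fin k × Fin m → Fin (k * m)
      to (a , i) = combine (shift (prefix e (toℕ i)) a) i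
      untwist : Fin k × Fin m → Fin k × Fin m
      untwist (a , i) = unshift (prefix e (toℕ i)) a , i
      from : Fin (k * m) → Fin k × Fin m
      from u = untwist (remQuot m u)
      to-from : ∀ u → to (from u) ≡ u
      to-from u = trans (cong (λ a → combine a (layer u)) (shift-unshift (prefix e (toℕ (layer u))) _)) (Fin.combine-remQuot {k} m u)
      from-to : ∀ p → from (to p) ≡ p
      from-to (a , i) = trans (cong untwist (Fin.remQuot-combine (shift (prefix e (toℕ i)) a) i))
                              (cong (_, i) (unshift-shift (prefix e (toℕ i)) a))

    -- In straightened coordinates all that remains of `e` is its total, applied on the way from the
    -- last layer back to layer 0.
    Next : Fin k × Fin m → Fin k × Fin m → Set
    Next (a , i) (b , j) =
      (suc (toℕ i) ≡ toℕ j × a ≡ b) ⊎ ((suc (toℕ i) ≡ m × toℕ j ≡ 0) × b ≡ shift (total e) a)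

    -- Adding the offset of layer i to its partial sum gives the partial sum of layer i + 1, and
    -- rotations are injective. Past the last layer the partial sum is the total; at layer 0 it is
    -- zero.
    Edge⇔Next : ∀ p q → Edge e (twist p) (twist q) ⇔ Next p q
    Edge⇔Next (a , i) (b , j) = mk⇔ to from
      where
      advance : shift (toℕ (lookup e i)) (shift (prefix e (toℕ i)) a) ≡ shift (prefix e (suc (toℕ i))) a
      advance = trans (shift-shift _ _ a) (cong (λ s → shift s a) (prefix-suc e i))
      close : suc (toℕ i) ≡ m → shift (prefix e (suc (toℕ i))) a ≡ shift (total e) a
      close p = cong (λ s → shift s a) (trans (cong (prefix e) p) (prefix-total e))
      start : toℕ j ≡ 0 → shift (prefix e (toℕ j)) b ≡ b
      start q = trans (cong (λ s → shift (prefix e s) b) q) (shift-multiple 0 (m*n%n≡0 0 k) b)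
      column : ∀ {t} → t ≡ toℕ j → shift (prefix e t) b ≡ shift (prefix e (toℕ j)) b
      column refl = refl
      to : Edge e (twist (a , i)) (twist (b , j)) → Next (a , i) (b , j)
      to (inj₁ p , x) = inj₁ (p , shift-injective _ (sym (trans (column p) (trans x advance))))
      to (inj₂ (p , q) , x) = inj₂ ((p , q) , trans (sym (start q)) (trans x (trans advance (close p))))
      from : Next (a , i) (b , j) → Edge e (twist (a , i)) (twist (b , j))
      from (inj₁ (p , refl)) = inj₁ p , trans (sym (column p)) (sym advance)
      from (inj₂ ((p , q) , x)) = inj₂ (p , q) , trans (start q) (trans x (trans (sym (close p)) (sym advance)))

    Adj-place : 2 ≤ m → ∀ p q → Adj (layered e) (Inverse.to place p) (Inverse.to place q) ⇔ (Next p q ⊎ Next q p)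
    Adj-place 2≤m p q = mk⇔ to from
      where
      module L = Equivalence (Adj-layered 2≤m e (twist p) (twist q))
      module N p q = Equivalence (Edge⇔Next p q)
      to : Adj (layered e) (Inverse.to place p) (Inverse.to place q) → Next p q ⊎ Next q p
      to x with L.to x
      ... | inj₁ y = inj₁ (N.to p q y)
      ... | inj₂ y = inj₂ (N.to q p y)
      from : Next p q ⊎ Next q p → Adj (layered e) (Inverse.to place p) (Inverse.to place q)
      from (inj₁ y) = L.from (inj₁ (N.from p q y))
      from (inj₂ y) = L.from (inj₂ (N.from q p y))

    -- The closing rotation is the identity, so every column is a cycle by itself.
    layered-cycles : 2 ≤ m → total e % k ≡ 0 → IsCycleUnion (layered e) k m
    layered-cycles 2≤m t≡0 = place , λ a b i j → mk⇔ (to a b i j) (from a b i j)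
      where
      closed : ∀ a → shift (total e) a ≡ a
      closed = shift-multiple (total e) t≡0
      next : ∀ {a b i j} → Next (a , i) (b , j) → a ≡ b × CycSucc m i j
      next (inj₁ (p , a≡b)) = a≡b , inj₁ p
      next (inj₂ (p , x))   = sym (trans x (closed _)) , inj₂ p
      next⁻ : ∀ {a i j} → CycSucc m i j → Next (a , i) (a , j)
      next⁻ (inj₁ p) = inj₁ (p , refl)
      next⁻ (inj₂ p) = inj₂ (p , sym (closed _))
      to : ∀ a b i j → Adj (layered e) (Inverse.to place (a , i)) (Inverse.to place (b , j)) → a ≡ b × Consec m i j
      to a b i j x with Equivalence.to (Adj-place 2≤m (a , i) (b , j)) x
      ... | inj₁ y = let (a≡b , s) = next y in a≡b , inj₁ s
      ... | inj₂ y = let (b≡a , s) = next y in sym b≡a , inj₂ s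
      from : ∀ a b i j → a ≡ b × Consec m i j → Adj (layered e) (Inverse.to place (a , i)) (Inverse.to place (b , j))
      from a b i j (refl , inj₁ s) = Equivalence.from (Adj-place 2≤m (a , i) (b , j)) (inj₁ (next⁻ s))
      from a b i j (refl , inj₂ s) = Equivalence.from (Adj-place 2≤m (a , i) (b , j)) (inj₂ (next⁻ s))

    -- The closing rotation is by one, so each column continues into the next and `Next` becomes
    -- `LexSucc`: the columns in turn form one tour.
    layered-single : 2 ≤ m → (total e + (k ∸ 1)) % k ≡ 0 → IsSingleCycle (layered e)
    layered-single 2≤m t≡1 = tour , λ a b t t′ → mk⇔ (to a b t t′) (from a b t t′)
      where
      dec : Fin (k * m) → Fin k × Fin m
      dec = remQuot {k} m
      tour : (Fin 1 × Fin (k * m)) ↔ Fin (k * m)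
      tour = mk↔ₛ′ (λ (_ , t) → Inverse.to place (dec t))
                   (λ u → zero , code (Inverse.from place u))
                   (λ u → trans (cong (Inverse.to place) (dec-code _)) (Inverse.strictlyInverseˡ place u))
                   (λ { (zero , t) → cong (zero ,_) (trans (cong code (Inverse.strictlyInverseʳ place (dec t)))
                                                          (Fin.combine-remQuot {k} m t)) })
        where
        code : Fin k × Fin m → Fin (k * m)
        code (a , i) = combine a i
        dec-code : ∀ p → dec (code p) ≡ p
        dec-code (a , i) = Fin.remQuot-combine a i
      next : ∀ {p q} → Next p q → LexSucc p q
      next (inj₁ x)              = inj₁ x
      next {a , _} (inj₂ (w , x)) =
        inj₂ (w , subst (CycSucc k a) (sym (trans x (shift-≡1 (total e) t≡1 a))) (CycSucc-shift-1 a))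
      next⁻ : ∀ {p q} → LexSucc p q → Next p q
      next⁻ (inj₁ x)              = inj₁ x
      next⁻ {a , _} (inj₂ (w , s)) =
        inj₂ (w , trans (CycSucc-functional s (CycSucc-shift-1 a)) (sym (shift-≡1 (total e) t≡1 a)))
      to : ∀ (a b : Fin 1) t t′ → Adj (layered e) (Inverse.to place (dec t)) (Inverse.to place (dec t′)) →
           a ≡ b × Consec (k * m) t t′
      to zero zero t t′ x with Equivalence.to (Adj-place 2≤m (dec t) (dec t′)) x
      ... | inj₁ y = refl , inj₁ (Equivalence.from (CycSucc⇔LexSucc t t′) (next y))
      ... | inj₂ y = refl , inj₂ (Equivalence.from (CycSucc⇔LexSucc t′ t) (next y))
      from : ∀ (a b : Fin 1) t t′ → a ≡ b × Consec (k * m) t t′ →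
             Adj (layered e) (Inverse.to place (dec t)) (Inverse.to place (dec t′))
      from a b t t′ (_ , inj₁ s) = Equivalence.from (Adj-place 2≤m (dec t) (dec t′))
                                     (inj₁ (next⁻ (Equivalence.to (CycSucc⇔LexSucc t t′) s)))
      from a b t t′ (_ , inj₂ s) = Equivalence.from (Adj-place 2≤m (dec t) (dec t′))
                                     (inj₂ (next⁻ (Equivalence.to (CycSucc⇔LexSucc t′ t) s)))

-- The degree of the input store

pairKey-injective : ∀ {n} (u v u′ v′ : Fin n) → pairKey n (toℕ u) (toℕ v) ≡ pairKey n (toℕ u′) (toℕ v′) →
                    u ≡ u′ × v ≡ v′
pairKey-injective {n} u v u′ v′ eq =
  Fin.combine-injective u v u′ v′
    (Fin.toℕ-injective (trans (position u v) (trans (ℕ.suc-injective eq) (sym (position u′ v′)))))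
  where
  position : ∀ (u v : Fin n) → toℕ (combine u v) ≡ toℕ u * n + toℕ v
  position u v = trans (Fin.toℕ-combine u v) (cong (_+ toℕ v) (ℕ.*-comm n (toℕ u)))

input-cong : ∀ {n} (x x′ : Graph n) key →
             (∀ u v → pairKey n (toℕ u) (toℕ v) ≡ key → x u v ≡ x′ u v) →
             storeOf (inputWrites n x) key ≡ storeOf (inputWrites n x′) key
input-cong {n} x x′ key agree =
  trans (storeOf-concatMap _ (allFin n) key)
  (trans (List.concatMap-cong (λ u →
            trans (storeOf-concatMap _ (allFin n) key)
            (trans (List.concatMap-cong (cell u) (allFin n))
                   (sym (storeOf-concatMap _ (allFin n) key)))) (allFin n))
         (sym (storeOf-concatMap _ (allFin n) key)))
  where
  entry : Graph n → Fin n → Fin n → List (ℕ × ℕ)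
  entry x u v = if ⌊ toℕ u <? toℕ v ⌋ then [ (pairKey n (toℕ u) (toℕ v) , bit (x u v)) ] else []
  cell : ∀ u v → storeOf (entry x u v) key ≡ storeOf (entry x′ u v) key
  cell u v with ⌊ toℕ u <? toℕ v ⌋
  ... | false = refl
  ... | true with pairKey n (toℕ u) (toℕ v) ≟ key
  ...   | yes eq = cong (λ z → storeOf [ (pairKey n (toℕ u) (toℕ v) , bit z) ] key) (agree u v eq)
  ...   | no ≢key = trans (absent x) (sym (absent x′))
    where
    absent : ∀ x → storeOf [ (pairKey n (toℕ u) (toℕ v) , bit (x u v)) ] key ≡ []
    absent x = cong (List.map proj₂) (List.filter-reject (λ p → proj₁ p ≟ key) ≢key)

-- A key names at most one pair of vertices, whose bit is decided by the offsets of their two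
-- layers. This is the initial 2 in `degreeAfter S 2`.
input-degree : ∀ {k m} .{{_ : NonZero k}} key →
               HasDegree {k} {m} 2 (λ e → respond (storeOf (inputWrites (k * m) (layered e))) key)
input-degree {k} {m} key φ
  with Fin.any? (λ u → Fin.any? (λ v → pairKey (k * m) (toℕ u) (toℕ v) ≟ key))
... | yes (u , v , here≡key) = junta (layer {k} u ∷ layer {k} v ∷ []) ℕ.≤-refl λ e e′ agree →
        cong (λ vs → φ (respond (λ _ → vs) key)) (input-cong (layered e) (layered e′) key λ u′ v′ eq →
          let (u≡ , v≡) = pairKey-injective u v u′ v′ (trans here≡key (sym eq)) in
          subst₂ (λ u v → layered e u v ≡ layered e′ u v) u≡ v≡
            (cong₂ (λ s s′ → does (Joined? s (remQuot m u) (remQuot m v) ⊎-dec Joined? s′ (remQuot m v) (remQuot m u)))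
                   (agree (here refl)) (agree (there (here refl)))))
... | no none = junta [] z≤n λ e e′ _ →
        cong (λ vs → φ (respond (λ _ → vs) key)) (input-cong (layered e) (layered e′) key λ u v eq → contradiction (u , v , eq) none)

-- The bound on the number of rounds

⟦⟧-yes : ∀ {P : Set} (P? : Dec P) → P → ⟦ P? ⟧ ≡ 1ℤ
⟦⟧-yes (yes _) _ = refl
⟦⟧-yes (no ¬p) p = contradiction p ¬p

⟦⟧-no : ∀ {P : Set} (P? : Dec P) → ¬ P → ⟦ P? ⟧ ≡ 0ℤ
⟦⟧-no (yes p) ¬p = contradiction p ¬p
⟦⟧-no (no _)  _  = refl

⟦⟧-nonneg : ∀ {P : Set} (P? : Dec P) → 0ℤ ℤ.≤ ⟦ P? ⟧
⟦⟧-nonneg (yes _) = ℤ.+≤+ z≤n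
⟦⟧-nonneg (no _)  = ℤ.≤-refl

total-zeros : ∀ {k} m → total (replicate m (zero {k})) ≡ 0
total-zeros zero    = refl
total-zeros (suc m) = total-zeros m

-- Otherwise acceptance would be orthogonal to `θ`, yet their correlation counts the configurations
-- of total 1 modulo `k`, and such configurations exist.
layers≤degree : ∀ {k m} S A → 2 ≤ k → 2 ≤ m → RespectsCapacity S A (k * m) → Computes1vsKCycle S A (k * m) k →
                m ≤ degreeAfter S 2 (rounds A)
layers≤degree {k@(suc (suc k-2))} {m@(suc m-1)} S A (s≤s (s≤s z≤n)) 2≤m capacity (single , cycles) =
  ℕ.≮⇒≥ λ d<m → 1≰0 (subst (1ℤ ℤ.≤_) (sum≡0 d<m) 1≤sum)
  where
  store : Config k m → Store
  store e = storeAt S A (k * m) (layered e) (rounds A)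

  accepts : Config k m → ℤ
  accepts e = ⟦ List.≡-dec _≟_ (respond (store e) answerKey) [ 1 ] ⟧

  accepts-degree : Degree≤ (degreeAfter S 2 (rounds A)) accepts
  accepts-degree = storeAt-degree S A (k * m) layered capacity input-degree (rounds A) ℕ.≤-refl answerKey
                     (λ vs → ⟦ List.≡-dec _≟_ vs [ 1 ] ⟧)

  output : ∀ {D v} → OutputIs D v → respond D answerKey ≡ [ v ]
  output {v = v} out = cong (λ vs → respond (λ _ → vs) answerKey) (out answerKey)

  accepts-single : ∀ e → (total e + (k ∸ 1)) % k ≡ 0 → accepts e ≡ 1ℤ
  accepts-single e t≡1 = ⟦⟧-yes (List.≡-dec _≟_ _ [ 1 ]) (output {store e} (single _ (layered-single e 2≤m t≡1)))

  rejects-cycles : ∀ e → total e % k ≡ 0 → accepts e ≡ 0ℤ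
  rejects-cycles e t≡0 = ⟦⟧-no (List.≡-dec _≟_ _ [ 1 ]) λ eq →
    0≢1 (trans (sym (output {store e} (cycles _ m refl (layered-cycles e 2≤m t≡0)))) eq)
    where
    0≢1 : ¬ ([ 0 ] ≡ [ 1 ])
    0≢1 ()

  ≡1? : ∀ t → Dec ((t + (k ∸ 1)) % k ≡ 0)
  ≡1? t = (t + (k ∸ 1)) % k ≟ 0

  -- θ is the indicator of t ≡ 1 minus that of t ≡ 0 (mod k), in telescoping form.
  g θ : ℕ → ℤ
  g t = ℤ.- ⟦ ≡1? t ⟧
  θ t = g (suc t) ℤ.- g t

  suc≡1 : ∀ t → (suc t + (k ∸ 1)) % k ≡ t % k
  suc≡1 t = trans (cong (_% k) (sym (ℕ.+-suc t (k ∸ 1)))) ([m+n]%n≡m%n t k)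

  g-periodic : ∀ t → g (t + k) ≡ g t
  g-periodic t = cong (λ r → ℤ.- ⟦ r ≟ 0 ⟧)
    (trans (cong (_% k) (trans (ℕ.+-assoc t k (k ∸ 1)) (trans (cong (t +_) (ℕ.+-comm k (k ∸ 1))) (sym (ℕ.+-assoc t (k ∸ 1) k)))))
           ([m+n]%n≡m%n (t + (k ∸ 1)) k))

  θ-balanced : Balanced k θ
  θ-balanced t = trans (sum-telescope k g t)
    (trans (cong (ℤ._- g t) (g-periodic t)) (ℤ.+-inverseʳ (g t)))

  -- Totals other than 0 and 1 modulo `k` have weight zero, so the behaviour of the algorithm on
  -- those graphs does not enter.
  correlation : ∀ e → θ (total e) ℤ.* accepts e ≡ ⟦ ≡1? (total e) ⟧
  correlation e = trans (expand ⟦ ≡1? (suc t) ⟧ ⟦ ≡1? t ⟧ (accepts e)) (trans (cong₂ ℤ._-_ at-1 at-0) (ℤ.+-identityʳ _))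
    where
    t = total e
    expand : ∀ a b c → (ℤ.- a ℤ.- ℤ.- b) ℤ.* c ≡ b ℤ.* c ℤ.- a ℤ.* c
    expand = ℤ.solve-∀
    at-0 : ⟦ ≡1? (suc t) ⟧ ℤ.* accepts e ≡ 0ℤ
    at-0 with ≡1? (suc t)
    ... | yes p = cong (1ℤ ℤ.*_) (rejects-cycles e (trans (sym (suc≡1 t)) p))
    ... | no _  = refl
    at-1 : ⟦ ≡1? t ⟧ ℤ.* accepts e ≡ ⟦ ≡1? t ⟧
    at-1 with ≡1? t
    ... | yes p = cong (1ℤ ℤ.*_) (accepts-single e p)
    ... | no _  = refl

  sum≡0 : degreeAfter S 2 (rounds A) < m → sumConfigs {k} m (λ e → ⟦ ≡1? (total e) ⟧) ≡ 0ℤ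
  sum≡0 d<m = trans (sumConfigs-cong m (λ e → sym (correlation e)))
                    (balanced-orthogonal {θ = θ} θ-balanced d<m accepts-degree)

  -- A configuration of total 1: its term is 1 and no term is negative, so the sum is positive.
  unit : Config k m
  unit = suc zero ∷ replicate m-1 zero

  1≤sum : 1ℤ ℤ.≤ sumConfigs {k} m (λ e → ⟦ ≡1? (total e) ⟧)
  1≤sum = subst (ℤ._≤ sumConfigs {k} m (λ e → ⟦ ≡1? (total e) ⟧))
    (⟦⟧-yes (≡1? (total unit)) (trans (cong (λ s → (suc s + (k ∸ 1)) % k) (total-zeros m-1)) (n%n≡0 k)))
    (term≤sumConfigs m (λ e → ⟦ ≡1? (total e) ⟧) (λ e → ⟦⟧-nonneg (≡1? (total e))) unit)

  1≰0 : ¬ (1ℤ ℤ.≤ 0ℤ)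
  1≰0 (ℤ.+≤+ ())

-- Exponents: from the degree bound to the number of rounds

-- Each round costs S (S + 1) ≤ 2 S², and the input contributes one more factor 2.
degreeAfter-bound : ∀ {S} → 1 ≤ S → ∀ r → degreeAfter S 2 r ≤ 2 ^ suc r * S ^ (2 * r)
degreeAfter-bound         1≤S zero    = ℕ.≤-refl
degreeAfter-bound {S} 1≤S (suc r) = begin
  S * (suc S * degreeAfter S 2 r)
    ≤⟨ ℕ.*-monoʳ-≤ S (ℕ.*-mono-≤ (ℕ.+-monoˡ-≤ S 1≤S) (degreeAfter-bound 1≤S r)) ⟩
  S * ((S + S) * (2 ^ suc r * S ^ (2 * r)))
    ≡⟨ collect S (2 ^ suc r) (S ^ (2 * r)) ⟩
  2 ^ suc (suc r) * (S * (S * S ^ (2 * r)))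
    ≡⟨ cong (λ x → 2 ^ suc (suc r) * S ^ x) (sym (ℕ.*-suc 2 r)) ⟩
  2 ^ suc (suc r) * S ^ (2 * suc r) ∎
  where
  open ℕ.≤-Reasoning
  collect : ∀ s x y → s * ((s + s) * (x * y)) ≡ 2 * x * (s * (s * y))
  collect = ℕ.solve-∀

cycle-length-bound : ∀ {n k m} S A → n ≡ k * m → 1 ≤ S → 2 ≤ k →
                     RespectsCapacity S A n → Computes1vsKCycle S A n k →
                     m ≤ 2 ^ suc (rounds A) * S ^ (2 * rounds A)
cycle-length-bound {m = m} S@(suc _) A refl 1≤S 2≤k capacity computes with 1 <? m
... | yes 2≤m = ℕ.≤-trans (layers≤degree S A 2≤k 2≤m capacity computes) (degreeAfter-bound 1≤S (rounds A))
-- With fewer than two layers the bound is immediate, its right-hand side being positive.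
... | no 2≰m  = ℕ.≤-trans (ℕ.≮⇒≥ 2≰m)
                  (ℕ.*-mono-≤ (ℕ.m^n>0 2 (suc (rounds A))) (ℕ.m^n>0 S (2 * rounds A)))

^-distribʳ-* : ∀ a b n → (a * b) ^ n ≡ a ^ n * b ^ n
^-distribʳ-* a b zero    = refl
^-distribʳ-* a b (suc n) =
  trans (cong (a * b *_) (^-distribʳ-* a b n)) (ℕ.[m*n]*[o*p]≡[m*o]*[n*p] a b (a ^ n) (b ^ n))

^-comm : ∀ a x y → (a ^ x) ^ y ≡ (a ^ y) ^ x
^-comm a x y = trans (ℕ.^-*-assoc a x y) (trans (cong (a ^_) (ℕ.*-comm x y)) (sym (ℕ.^-*-assoc a y x)))

-- Of the gap between the integer exponents just one factor `n` is kept.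
^-cancel-≤ : ∀ {n a b c} .{{_ : NonZero n}} → a < b → n ^ b ≤ c * n ^ a → n ≤ c
^-cancel-≤ {n} {a} {b} {c} a<b h =
  ℕ.*-cancelʳ-≤ n c (n ^ a) {{ℕ.m^n≢0 n a}} (ℕ.≤-trans (ℕ.^-monoʳ-≤ n a<b) h)

-- Raising to the powers `δq` and `εq` clears the rational exponents. With too few rounds the power
-- of `n` on the right stays below that on the left, which confines `n` to a constant.
size-bound : ∀ {n k m S C b R δp δq εp εq} .{{_ : NonZero n}} → n ≡ k * m →
             δp < δq → k ^ δq ≤ C * n ^ δp → m ≤ b * S ^ (2 * R) → S ^ εq ≤ n ^ εp →
             2 * δq * R * εp < εq → n ≤ (C * b ^ δq) ^ εq
size-bound {n} {k} {m} {S} {C} {b} {R} {δp} {δq} {εp} {εq} n≡km δp<δq k≤ m≤ S≤ R< =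
  ^-cancel-≤ R< (begin
    n ^ εq                                       ≤⟨ ℕ.^-monoˡ-≤ εq n≤ ⟩
    (C * b ^ δq * S ^ (2 * R * δq)) ^ εq         ≡⟨ ^-distribʳ-* (C * b ^ δq) _ εq ⟩
    (C * b ^ δq) ^ εq * (S ^ (2 * R * δq)) ^ εq  ≡⟨ cong ((C * b ^ δq) ^ εq *_) (^-comm S (2 * R * δq) εq) ⟩
    (C * b ^ δq) ^ εq * (S ^ εq) ^ (2 * R * δq)  ≤⟨ ℕ.*-monoʳ-≤ ((C * b ^ δq) ^ εq) (ℕ.^-monoˡ-≤ (2 * R * δq) S≤) ⟩
    (C * b ^ δq) ^ εq * (n ^ εp) ^ (2 * R * δq)
      ≡⟨ cong ((C * b ^ δq) ^ εq *_) (trans (ℕ.^-*-assoc n εp (2 * R * δq)) (cong (n ^_) (exponent εp R δq))) ⟩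
    (C * b ^ δq) ^ εq * n ^ (2 * δq * R * εp)    ∎)
  where
  open ℕ.≤-Reasoning
  exponent : ∀ x r y → x * (2 * r * y) ≡ 2 * y * r * x
  exponent = ℕ.solve-∀
  -- As δ < 1, the factor `k` cannot account for all of `n`: a power of the cycle length `m`
  -- dominates it up to `C`.
  n≤C*m^δq : n ≤ C * m ^ δq
  n≤C*m^δq = ^-cancel-≤ δp<δq (begin
    n ^ δq                ≡⟨ cong (_^ δq) n≡km ⟩
    (k * m) ^ δq          ≡⟨ ^-distribʳ-* k m δq ⟩
    k ^ δq * m ^ δq       ≤⟨ ℕ.*-monoˡ-≤ (m ^ δq) k≤ ⟩
    C * n ^ δp * m ^ δq   ≡⟨ exchange C (n ^ δp) (m ^ δq) ⟩
    C * m ^ δq * n ^ δp   ∎)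
    where
    exchange : ∀ x y z → x * y * z ≡ x * z * y
    exchange = ℕ.solve-∀
  n≤ : n ≤ C * b ^ δq * S ^ (2 * R * δq)
  n≤ = begin
    n                                     ≤⟨ n≤C*m^δq ⟩
    C * m ^ δq                            ≤⟨ ℕ.*-monoʳ-≤ C (ℕ.^-monoˡ-≤ δq m≤) ⟩
    C * (b * S ^ (2 * R)) ^ δq            ≡⟨ cong (C *_) (^-distribʳ-* b (S ^ (2 * R)) δq) ⟩
    C * (b ^ δq * (S ^ (2 * R)) ^ δq)     ≡⟨ cong (λ x → C * (b ^ δq * x)) (ℕ.^-*-assoc S (2 * R) δq) ⟩
    C * (b ^ δq * S ^ (2 * R * δq))       ≡⟨ ℕ.*-assoc C (b ^ δq) _ ⟨
    C * b ^ δq * S ^ (2 * R * δq)         ∎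

capacity-positive : ∀ {n S εp εq} .{{_ : NonZero n}} → n ^ εp < suc S ^ εq → 1 ≤ S
capacity-positive {n} {zero}  {εp} {εq} n< =
  contradiction (ℕ.m^n>0 n εp) (ℕ.<⇒≱ (subst (n ^ εp <_) (ℕ.^-zeroˡ εq) n<))
capacity-positive {S = suc _} n< = s≤s z≤n

theorem1p4 :
  -- δ = δp / δq ∈ (0,1)
  (δp δq : ℕ) → 0 < δp → δp < δq →
  -- a constant c = 1 / c′ > 0 (hidden in Ω), depending only on δ
  ∃[ c′ ] (1 ≤ c′ ×
    ( -- ε = εp / εq ∈ (0,1)
      (εp εq : ℕ) → 0 < εp → εp < εq →
      -- k = k(n) with k = O(n^δ)
      (k : ℕ → ℕ) →
      (∃[ C ] ∃[ n₁ ] ((n : ℕ) → n ≥ n₁ → k n ^ δq ≤ C * n ^ δp)) →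
      ∃[ n₀ ] ((n : ℕ) → n ≥ n₀ → 2 ≤ k n → k n ∣ n →
        -- S = ⌊ n^ε ⌋
        (S : ℕ) → S ^ εq ≤ n ^ εp → n ^ εp < suc S ^ εq →
        (A : AMPC) → RespectsCapacity S A n → Computes1vsKCycle S A n (k n) →
        -- rounds ≥ c / ε
        εq ≤ c′ * rounds A * εp)))
-- In c′ = 2 δq, the 2 comes from the two factors `S` per round and `δq` from the denominator of δ.
theorem1p4 δp δq@(suc _) 0<δp δp<δq = 2 * δq , s≤s z≤n ,
  λ { εp@(suc _) εq 0<εp εp<εq k (C , n₁ , k≤) →
      -- The threshold exceeds both `n₁` and the constant of `size-bound` for b = 2 ^ εq.
      suc (n₁ + (C * (2 ^ εq) ^ δq) ^ εq) ,
      λ { n@(suc _) n≥n₀ 2≤k (divides m n≡m*k) S S≤ S> A capacity computes →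
          ℕ.≮⇒≥ λ R< →
            let R   = rounds A
                -- If the claim fails then R < εq, so the factor 2 ^ (R + 1) is at most 2 ^ εq,
                -- which does not depend on `n`.
                R<q : R < εq
                R<q = ℕ.≤-<-trans (ℕ.≤-trans (ℕ.m≤n*m R (2 * δq)) (ℕ.m≤m*n (2 * δq * R) εp)) R<
                n≡km = trans n≡m*k (ℕ.*-comm m (k n))
                m≤  : m ≤ 2 ^ εq * S ^ (2 * R)
                m≤  = ℕ.≤-trans
                        (cycle-length-bound S A n≡km (capacity-positive {n} {S} {εp} {εq} S>) 2≤k capacity computes)
                        (ℕ.*-monoˡ-≤ (S ^ (2 * R)) (ℕ.^-monoʳ-≤ 2 R<q))
            in contradiction (size-bound {k = k n} {S = S} {C} {2 ^ εq} {R} n≡km δp<δq (k≤ n (ℕ.≤-trans (ℕ.m≤n⇒m≤1+n (ℕ.m≤m+n n₁ _)) n≥n₀)) m≤ S≤ R<)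
                             (ℕ.<⇒≱ (ℕ.≤-trans (s≤s (ℕ.m≤n+m _ n₁)) n≥n₀)) } }
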